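{- Let $c_2,c_3$ be integers with $3\leq c_2\leq c_3$, and let $e=1+c_2+c_3$. Then $$\lambda(P_{1,c_2,c_3})=\begin{cases}5&\text{if }e\leq10;\\ \left\lceil\frac{ -1+\sqrt{8e+1}}{2}\right\rceil&\text{if }e\geq11\text{ and }\left\lceil\frac{ -1+\sqrt{8e+1}}{2}\right\rceil\text{ is odd};\\ \left\lceil\sqrt{2e}\right\rceil&\text{otherwise.}\end{cases}$$
   Context: For a graph $G$ (simple graph with at most one loop at each vertex), the edge-distinguishing chromatic number $\lambda(G)$ is the minimum positive integer $k$ for which there is a vertex coloring $c:V(G)\to\{1,\dotsc,k\}$ such that the edge labels $\{c(u),c(v)\}$ (a one-element set for a loop) are distinct for distinct edges $uv$. The petal graph $P_{1,c_2,c_3}$ consists of a vertex $u_0$ with a loop at $u_0$, together with a cycle through $u_0$ of length $c_2$ and a cycle through $u_0$ of length $c_3$, these sharing only $u_0$; it has $1+c_2+c_3$ edges. -}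

module Defs where

open import Data.Nat using (ℕ; zero; suc; _+_; _*_; _∸_; _≤_; _<_)
open import Data.Fin using (Fin; zero; suc; inject₁; fromℕ)
open import Data.Product using (_×_; _,_; Σ; ∃)
open import Data.Sum using (_⊎_)
open import Relation.Binary.PropositionalEquality using (_≡_)
open import Relation.Nullary using (¬_)

record Graph : Set₁ where
  field
    V    : Set
    E    : Set
    ends : E → V × V
open Graph public

-- Equality of the unordered edge labels {x , y} = {x' , y'} (as sets).
-- For a loop the label {x , x} is the one-element set {x}.
SameLabel : ∀ {A : Set} → A × A → A × A → Set
SameLabel (x , y) (x' , y') = ((x ≡ x') × (y ≡ y')) ⊎ ((x ≡ y') × (y ≡ x'))

label : ∀ {k} (G : Graph) → (V G → Fin k) → E G → Fin k × Fin k
label G c e with ends G e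
... | (u , v) = (c u , c v)

EdgeDistinguishing : ∀ {k} (G : Graph) → (V G → Fin k) → Set
EdgeDistinguishing G c = ∀ e e' → SameLabel (label G c e) (label G c e') → e ≡ e'

EDColourable : Graph → ℕ → Set
EDColourable G k = Σ (V G → Fin k) (λ c → EdgeDistinguishing G c)

EDChromaticNumber : Graph → ℕ → Set
EDChromaticNumber G k =
  (0 < k) × EDColourable G k × (∀ j → 0 < j → j < k → ¬ EDColourable G j)

-- Petal graph with a loop at u0 and two cycles through u0 of lengths
-- suc m2 and suc m3.  Cycle A is u0 = pos 0, a 0, …, a (m2-1), back to u0.
data PetalV (m2 m3 : ℕ) : Set where
  u0 : PetalV m2 m3
  a  : Fin m2 → PetalV m2 m3
  b  : Fin m3 → PetalV m2 m3

data PetalE (m2 m3 : ℕ) : Set where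
  loop   : PetalE m2 m3
  aPath  : Fin m2 → PetalE m2 m3
  aClose : PetalE m2 m3
  bPath  : Fin m3 → PetalE m2 m3
  bClose : PetalE m2 m3

posA : ∀ {m2 m3} → Fin (suc m2) → PetalV m2 m3
posA zero    = u0
posA (suc i) = a i

posB : ∀ {m2 m3} → Fin (suc m3) → PetalV m2 m3
posB zero    = u0
posB (suc i) = b i

petalEnds : ∀ {m2 m3} → PetalE m2 m3 → PetalV m2 m3 × PetalV m2 m3
petalEnds loop      = (u0 , u0)
petalEnds (aPath i) = (posA (inject₁ i) , a i)
petalEnds {m2} aClose = (posA (fromℕ m2) , u0)
petalEnds (bPath i) = (posB (inject₁ i) , b i)
petalEnds {m3 = m3} bClose = (posB (fromℕ m3) , u0)

PetalAux : ℕ → ℕ → Graph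
PetalAux m2 m3 = record { V = PetalV m2 m3 ; E = PetalE m2 m3 ; ends = petalEnds }

-- P_{1,c2,c3}: loop at u0, cycles of lengths c2 and c3 through u0
-- (meaningful for c2, c3 ≥ 3; then it has 1 + c2 + c3 edges).
Petal : ℕ → ℕ → Graph
Petal c2 c3 = PetalAux (c2 ∸ 1) (c3 ∸ 1)

IsLeast : (ℕ → Set) → ℕ → Set
IsLeast P k = P k × (∀ j → j < k → ¬ P j)

-- ⌈(-1 + √(8e+1))/2⌉ is the least k with 2e ≤ k(k+1)
CeilTri : ℕ → ℕ → Set
CeilTri e = IsLeast (λ k → 2 * e ≤ k * (k + 1))

-- ⌈√(2e)⌉ is the least k with 2e ≤ k²
CeilSqrt2 : ℕ → ℕ → Set
CeilSqrt2 e = IsLeast (λ k → 2 * e ≤ k * k)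

Odd : ℕ → Set
Odd n = ∃ λ m → n ≡ suc (2 * m)

{-# OPTIONS --safe #-}

-- A colouring of the petal graph is a closed walk of colours x, x, a₁, …, x, b₁, …, x whose
-- steps have distinct labels.  A colour met r times on the walk has 2r half-edges, and at
-- most k + 1 are available (k − 1 proper edges and two halves of a loop), so r ≤ ⌈k/2⌉ and
-- the graph has at most k ⌈k/2⌉ edges; the root colour is met three times, so k ≥ 5.
-- These two conditions are also sufficient.  By induction on k, one closed trail at 0
-- through exactly all edges gained (up to a perfect matching when k is even) in passing
-- from k to k + 2 colours extends the longer cycle; the cases in which that cycle is too
-- short occur only for k ≤ 9 and are checked by computation.
module Submission where

open import Defs
open import Data.Bool using (true; false; Bool; _∧_; not; if_then_else_)
open import Data.Bool.ListAction using (any)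
open import Data.Empty using (⊥-elim)
open import Data.Fin using (Fin; zero; suc; inject₁; fromℕ; toℕ; fromℕ<)
open import Data.Fin.Properties using (toℕ<n; toℕ-injective; toℕ-fromℕ<)
open import Data.List using (List; []; _∷_; _++_; map; length; filter; concatMap; tabulate; lookup)
open import Data.List.Membership.Propositional using (_∈_)
open import Data.List.Membership.Propositional.Properties using (∈-lookup; ∈-++⁺ˡ; ∈-++⁺ʳ; ∈-tabulate⁺)
open import Data.List.Properties using (map-++; length-++; map-tabulate; tabulate-lookup; tabulate-cong; length-tabulate; filter-++; filter-accept; filter-reject; ++-assoc)
open import Data.List.Relation.Binary.Disjoint.Propositional using (Disjoint)
open import Data.List.Relation.Binary.Permutation.Propositional using (_↭_; prep; ↭-sym; ↭⇒↭ₛ)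
open import Data.List.Relation.Binary.Permutation.Propositional.Properties using (↭-length; filter-↭; ∷↭∷ʳ; ++-comm) renaming (++⁺ to ↭-++⁺)
import Data.List.Relation.Binary.Permutation.Setoid.Properties as ↭ₛ
open import Data.List.Relation.Unary.All as All using (All; []; _∷_)
open import Data.List.Relation.Unary.All.Properties as Allₚ using (all-filter)
open import Data.List.Relation.Unary.AllPairs as AllPairs using (AllPairs; []; _∷_; allPairs?)
import Data.List.Relation.Unary.AllPairs.Properties as AllPairsₚ
open import Data.List.Relation.Unary.Any as Any using (Any; here; there)
open import Data.List.Relation.Unary.Unique.Propositional using (Unique)
import Data.List.Relation.Unary.Unique.Propositional.Properties as Uniqueₚ
open import Data.Nat using (ℕ; zero; suc; _+_; _*_; _∸_; _≤_; _<_; z≤n; s≤s; ⌊_/2⌋; ⌈_/2⌉; _≟_; _≤?_; _<?_; _≤ᵇ_; _≡ᵇ_)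
open import Data.Nat.Properties
open import Data.Nat.Solver using (module +-*-Solver)
open import Data.Product using (_×_; _,_; ∃; proj₁; proj₂)
open import Data.Sum using (_⊎_; inj₁; inj₂)
open import Function using (_∘_; flip)
open import Relation.Binary.Definitions using (Symmetric; tri<; tri≈; tri>)
open import Relation.Binary.PropositionalEquality
open import Relation.Nullary using (¬_; Dec; yes; no; contradiction)
open import Relation.Nullary.Decidable using (from-yes; _×-dec_; _⊎-dec_; _→-dec_; ¬?)

-- Edge labels and when they differ

Step : Set
Step = ℕ × ℕ

Distinct : Step → Step → Set
Distinct s t = ¬ SameLabel s t

sameLabel-sym : ∀ {A : Set} {s t : A × A} → SameLabel s t → SameLabel t s
sameLabel-sym (inj₁ (refl , refl)) = inj₁ (refl , refl)
sameLabel-sym (inj₂ (refl , refl)) = inj₂ (refl , refl)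

sameLabel-trans : ∀ {A : Set} {s t r : A × A} → SameLabel s t → SameLabel t r → SameLabel s r
sameLabel-trans (inj₁ (refl , refl)) q                    = q
sameLabel-trans (inj₂ (refl , refl)) (inj₁ (refl , refl)) = inj₂ (refl , refl)
sameLabel-trans (inj₂ (refl , refl)) (inj₂ (refl , refl)) = inj₁ (refl , refl)

sameLabel? : (s t : Step) → Dec (SameLabel s t)
sameLabel? (x , y) (x' , y') = ((x ≟ x') ×-dec (y ≟ y')) ⊎-dec ((x ≟ y') ×-dec (y ≟ x'))

distinct-sym : Symmetric Distinct
distinct-sym s≁t = s≁t ∘ sameLabel-sym

Some Every : (ℕ → Set) → Step → Set
Some  P (x , y) = P x ⊎ P y
Every P (x , y) = P x × P y

-- Equal labels have the same colours, so a property separates them. Below, `P` is either equality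
-- with one colour or a bound dividing old colours from new ones.
some-every-distinct : ∀ {P : ℕ → Set} {s t} → Some P s → Every (¬_ ∘ P) t → Distinct s t
some-every-distinct (inj₁ p) (¬p , _) (inj₁ (refl , refl)) = ¬p p
some-every-distinct (inj₂ p) (_ , ¬p) (inj₁ (refl , refl)) = ¬p p
some-every-distinct (inj₁ p) (_ , ¬p) (inj₂ (refl , refl)) = ¬p p
some-every-distinct (inj₂ p) (¬p , _) (inj₂ (refl , refl)) = ¬p p

-- Closed walks

steps : ℕ → List ℕ → List Step
steps x []       = []
steps x (y ∷ ys) = (x , y) ∷ steps y ys

circuit : ℕ → List ℕ → List Step
circuit x ws = steps x (ws ++ x ∷ [])

petalSteps : ℕ → List ℕ → List ℕ → List Step
petalSteps x as bs = (x , x) ∷ circuit x as ++ circuit x bs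

steps-++ : ∀ x ys z zs → steps x (ys ++ z ∷ zs) ≡ steps x (ys ++ z ∷ []) ++ steps z zs
steps-++ x []       z zs = refl
steps-++ x (y ∷ ys) z zs = cong ((x , y) ∷_) (steps-++ y ys z zs)

steps-every : ∀ {P : ℕ → Set} {x ys} → P x → All P ys → All (Every P) (steps x ys)
steps-every px []         = []
steps-every px (py ∷ pys) = (px , py) ∷ steps-every py pys

circuit-every : ∀ {P : ℕ → Set} {x ws} → P x → All P ws → All (Every P) (circuit x ws)
circuit-every px pws = steps-every px (Allₚ.++⁺ pws (px ∷ []))

sources-circuit : ∀ x ws → map proj₁ (circuit x ws) ≡ x ∷ ws
sources-circuit x ws = go x ws x
  where
  -- The endpoint `z` is kept apart from the start, which moves along the walk during the induction.
  go : ∀ x ws z → map proj₁ (steps x (ws ++ z ∷ [])) ≡ x ∷ ws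
  go x []       z = refl
  go x (w ∷ ws) z = cong (x ∷_) (go w ws z)

targets-steps : ∀ x ys → map proj₂ (steps x ys) ≡ ys
targets-steps x []       = refl
targets-steps x (y ∷ ys) = cong (y ∷_) (targets-steps y ys)

-- Each cycle in `petalEnds` joins consecutive positions `inject₁ i` and `suc i` and then closes up;
-- this reads such a list of edges as a walk.
tabulate-steps : ∀ {m} (f : Fin (suc m) → ℕ) y →
  tabulate (λ i → (f (inject₁ i) , f (suc i))) ++ (f (fromℕ m) , y) ∷ []
    ≡ steps (f zero) (tabulate (f ∘ suc) ++ y ∷ [])
tabulate-steps {zero}  f y = refl
tabulate-steps {suc m} f y = cong ((f zero , f (suc zero)) ∷_) (tabulate-steps (f ∘ suc) y)

-- Colours are natural numbers with separate bounds, so the same walks serve for larger palettes.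
-- The lists hold the colours of the vertices other than the root, so the cycle lengths are `suc m₂`
-- and `suc m₃`.
record Trails (x k m₂ m₃ : ℕ) : Set where
  constructor trails
  field
    as bs     : List ℕ
    |as|      : length as ≡ m₂
    |bs|      : length bs ≡ m₃
    x<k       : x < k
    as<k      : All (_< k) as
    bs<k      : All (_< k) bs
    distinct  : AllPairs Distinct (petalSteps x as bs)

trails-suc : ∀ {x k m₂ m₃} → Trails x k m₂ m₃ → Trails x (suc k) m₂ m₃
trails-suc (trails as bs |as| |bs| x<k as<k bs<k d) =
  trails as bs |as| |bs| (m<n⇒m<1+n x<k) (All.map m<n⇒m<1+n as<k) (All.map m<n⇒m<1+n bs<k) d

trails-swap : ∀ {x k m₂ m₃} → Trails x k m₂ m₃ → Trails x k m₃ m₂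
trails-swap {x} (trails as bs |as| |bs| x<k as<k bs<k d) =
  trails bs as |bs| |as| x<k bs<k as<k
    (↭ₛ.AllPairs-resp-↭ (setoid Step) distinct-sym (resp₂ Distinct)
      (↭⇒↭ₛ (prep _ (++-comm (circuit x as) (circuit x bs)))) d)

-- Colourings of the petal graph as pairs of closed walks

aEdges bEdges petalEdges : ∀ m₂ m₃ → List (PetalE m₂ m₃)
aEdges m₂ m₃ = tabulate aPath ++ aClose ∷ []
bEdges m₂ m₃ = tabulate bPath ++ bClose ∷ []
petalEdges m₂ m₃ = loop ∷ aEdges m₂ m₃ ++ bEdges m₂ m₃

∈-petalEdges : ∀ {m₂ m₃} (e : PetalE m₂ m₃) → e ∈ petalEdges m₂ m₃
∈-petalEdges loop      = here refl
∈-petalEdges (aPath i) = there (∈-++⁺ˡ (∈-++⁺ˡ (∈-tabulate⁺ i)))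
∈-petalEdges aClose    = there (∈-++⁺ˡ (∈-++⁺ʳ (tabulate aPath) (here refl)))
∈-petalEdges (bPath i) = there (∈-++⁺ʳ (aEdges _ _) (∈-++⁺ˡ (∈-tabulate⁺ i)))
∈-petalEdges bClose    = there (∈-++⁺ʳ (aEdges _ _) (∈-++⁺ʳ (tabulate bPath) (here refl)))

-- Together with `∈-petalEdges` this lets `AllPairs` over the list replace the quantifier over all
-- pairs of edges in `EdgeDistinguishing`.
petalEdges-unique : ∀ m₂ m₃ → Unique (petalEdges m₂ m₃)
petalEdges-unique m₂ m₃ =
  Allₚ.++⁺ (aEdges-all (λ _ ()) λ ()) (bEdges-all (λ _ ()) λ ())
  ∷ AllPairsₚ.++⁺
      (AllPairsₚ.++⁺ (AllPairsₚ.tabulate⁺ {f = aPath} λ { i≢i refl → i≢i refl }) ([] ∷ [])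
        (Allₚ.tabulate⁺ {f = aPath} λ _ → (λ ()) ∷ []))
      (AllPairsₚ.++⁺ (AllPairsₚ.tabulate⁺ {f = bPath} λ { i≢i refl → i≢i refl }) ([] ∷ [])
        (Allₚ.tabulate⁺ {f = bPath} λ _ → (λ ()) ∷ []))
      (aEdges-all (λ _ → bEdges-all (λ _ ()) λ ()) (bEdges-all (λ _ ()) λ ()))
  where
  aEdges-all : ∀ {P : PetalE m₂ m₃ → Set} → (∀ i → P (aPath i)) → P aClose → All P (aEdges m₂ m₃)
  aEdges-all path close = Allₚ.++⁺ (Allₚ.tabulate⁺ path) (close ∷ [])
  bEdges-all : ∀ {P : PetalE m₂ m₃ → Set} → (∀ i → P (bPath i)) → P bClose → All P (bEdges m₂ m₃)
  bEdges-all path close = Allₚ.++⁺ (Allₚ.tabulate⁺ path) (close ∷ [])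

endColours : ∀ {m₂ m₃} → (PetalV m₂ m₃ → ℕ) → PetalE m₂ m₃ → Step
endColours c e = c (proj₁ (petalEnds e)) , c (proj₂ (petalEnds e))

endColours-petalEdges : ∀ {m₂ m₃} (c : PetalV m₂ m₃ → ℕ) →
  map (endColours c) (petalEdges m₂ m₃) ≡ petalSteps (c u0) (tabulate (c ∘ a)) (tabulate (c ∘ b))
endColours-petalEdges {m₂} {m₃} c = cong ((c u0 , c u0) ∷_) (begin
  map (endColours c) (aEdges m₂ m₃ ++ bEdges m₂ m₃)
    ≡⟨ map-++ (endColours c) (aEdges m₂ m₃) _ ⟩
  map (endColours c) (aEdges m₂ m₃) ++ map (endColours c) (bEdges m₂ m₃)
    ≡⟨ cong₂ _++_ (map-++ (endColours c) (tabulate aPath) _) (map-++ (endColours c) (tabulate bPath) _) ⟩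
  (map (endColours c) (tabulate aPath) ++ endColours c aClose ∷ [])
    ++ (map (endColours c) (tabulate bPath) ++ endColours c bClose ∷ [])
    ≡⟨ cong₂ (λ α β → (α ++ endColours c aClose ∷ []) ++ (β ++ endColours c bClose ∷ []))
             (map-tabulate aPath (endColours c)) (map-tabulate bPath (endColours c)) ⟩
  (tabulate (endColours c ∘ aPath) ++ endColours c aClose ∷ [])
    ++ (tabulate (endColours c ∘ bPath) ++ endColours c bClose ∷ [])
    ≡⟨ cong₂ _++_ (tabulate-steps (c ∘ posA) (c u0)) (tabulate-steps (c ∘ posB) (c u0)) ⟩
  circuit (c u0) (tabulate (c ∘ a)) ++ circuit (c u0) (tabulate (c ∘ b)) ∎)
  where open ≡-Reasoning

allPairs-∈ : ∀ {A : Set} {R : A → A → Set} → Symmetric R →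
  ∀ {xs x y} → AllPairs R xs → x ∈ xs → y ∈ xs → x ≡ y ⊎ R x y
allPairs-∈ R-sym (p ∷ ps) (here refl) (here refl) = inj₁ refl
allPairs-∈ R-sym (p ∷ ps) (here refl) (there j)   = inj₂ (All.lookup p j)
allPairs-∈ R-sym (p ∷ ps) (there i)   (here refl) = inj₂ (R-sym (All.lookup p i))
allPairs-∈ R-sym (p ∷ ps) (there i)   (there j)   = allPairs-∈ R-sym ps i j

-- `label` is defined by `with` and is stuck on a variable edge; abstracting `petalEnds e` releases
-- it.
label-toℕ : ∀ {k m₂ m₃} (c : PetalV m₂ m₃ → Fin k) e →
  endColours (toℕ ∘ c) e ≡ (toℕ (proj₁ (label (PetalAux m₂ m₃) c e)) , toℕ (proj₂ (label (PetalAux m₂ m₃) c e)))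
label-toℕ c e with petalEnds e
... | _ , _ = refl

sameLabel-toℕ : ∀ {k} {p q : Fin k × Fin k} → SameLabel p q →
  SameLabel (toℕ (proj₁ p) , toℕ (proj₂ p)) (toℕ (proj₁ q) , toℕ (proj₂ q))
sameLabel-toℕ (inj₁ (refl , refl)) = inj₁ (refl , refl)
sameLabel-toℕ (inj₂ (refl , refl)) = inj₂ (refl , refl)

sameLabel-toℕ⁻ : ∀ {k} {p q : Fin k × Fin k} →
  SameLabel (toℕ (proj₁ p) , toℕ (proj₂ p)) (toℕ (proj₁ q) , toℕ (proj₂ q)) → SameLabel p q
sameLabel-toℕ⁻ (inj₁ (x , y)) = inj₁ (toℕ-injective x , toℕ-injective y)
sameLabel-toℕ⁻ (inj₂ (x , y)) = inj₂ (toℕ-injective x , toℕ-injective y)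

colouring⇒trails : ∀ {k m₂ m₃} → EDColourable (PetalAux m₂ m₃) k → ∃ λ x → Trails x k m₂ m₃
colouring⇒trails {k} {m₂} {m₃} (c , ed) =
  toℕ (c u0) ,
  trails (tabulate (toℕ ∘ c ∘ a)) (tabulate (toℕ ∘ c ∘ b))
    (length-tabulate _) (length-tabulate _) (toℕ<n (c u0))
    (Allₚ.tabulate⁺ (toℕ<n ∘ c ∘ a)) (Allₚ.tabulate⁺ (toℕ<n ∘ c ∘ b))
    (subst (AllPairs Distinct) (endColours-petalEdges (toℕ ∘ c))
      (AllPairsₚ.map⁺ (AllPairs.map (λ {e} {e'} e≢e' same → e≢e' (ed e e' (lower {e} {e'} same))) (petalEdges-unique m₂ m₃))))
  where
  lower : ∀ {e e'} → SameLabel (endColours (toℕ ∘ c) e) (endColours (toℕ ∘ c) e') →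
          SameLabel (label (PetalAux m₂ m₃) c e) (label (PetalAux m₂ m₃) c e')
  lower {e} {e'} same = sameLabel-toℕ⁻ {p = label (PetalAux m₂ m₃) c e} {label (PetalAux m₂ m₃) c e'}
    (subst₂ SameLabel (label-toℕ c e) (label-toℕ c e') same)

trails⇒colouring : ∀ {x k m₂ m₃} → Trails x k m₂ m₃ → EDColourable (PetalAux m₂ m₃) k
trails⇒colouring {x} {k} (trails as bs refl refl x<k as<k bs<k d) = c , ed
  where
  c : PetalV (length as) (length bs) → Fin k
  c u0    = fromℕ< x<k
  c (a i) = fromℕ< (All.lookup as<k (∈-lookup i))
  c (b i) = fromℕ< (All.lookup bs<k (∈-lookup i))

  colours : map (endColours (toℕ ∘ c)) (petalEdges (length as) (length bs)) ≡ petalSteps x as bs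
  colours
    rewrite endColours-petalEdges (toℕ ∘ c)
          | toℕ-fromℕ< x<k
          | tabulate-cong (λ i → toℕ-fromℕ< (All.lookup as<k (∈-lookup i)))
          | tabulate-cong (λ i → toℕ-fromℕ< (All.lookup bs<k (∈-lookup i)))
          | tabulate-lookup as | tabulate-lookup bs = refl

  pairs : AllPairs (λ e e' → Distinct (endColours (toℕ ∘ c) e) (endColours (toℕ ∘ c) e')) (petalEdges _ _)
  pairs = AllPairsₚ.map⁻ (subst (AllPairs Distinct) (sym colours) d)

  ed : EdgeDistinguishing (PetalAux _ _) c
  ed e e' same with allPairs-∈ (λ {e} {e'} → distinct-sym {endColours (toℕ ∘ c) e} {endColours (toℕ ∘ c) e'})
                      pairs (∈-petalEdges e) (∈-petalEdges e')
  ... | inj₁ e≡e' = e≡e'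
  ... | inj₂ e≁e' = contradiction
          (subst₂ SameLabel (sym (label-toℕ c e)) (sym (label-toℕ c e')) (sameLabel-toℕ {p = label (PetalAux _ _) c e} {label (PetalAux _ _) c e'} same)) e≁e'

-- The capacity bound

-- For odd `k` this is k(k+1)/2, the number of all edges and loops on `k` vertices; for even `k` it
-- is k²/2, which is k/2 fewer, the size of a perfect matching.
capacity : ℕ → ℕ
capacity k = k * ⌈ k /2⌉

occurrences : ℕ → List ℕ → ℕ
occurrences x ws = length (filter (x ≟_) ws)

occurrences-≡ : ∀ {x y} → x ≡ y → ∀ ws → occurrences x (y ∷ ws) ≡ suc (occurrences x ws)
occurrences-≡ {x} x≡y ws = cong length (filter-accept (x ≟_) x≡y)

occurrences-≢ : ∀ {x y} → x ≢ y → ∀ ws → occurrences x (y ∷ ws) ≡ occurrences x ws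
occurrences-≢ {x} x≢y ws = cong length (filter-reject (x ≟_) x≢y)

occurrences-↭ : ∀ x {ws vs} → ws ↭ vs → occurrences x ws ≡ occurrences x vs
occurrences-↭ x ws↭vs = ↭-length (filter-↭ (x ≟_) ws↭vs)

occurrences-++ : ∀ x ws vs → occurrences x (ws ++ vs) ≡ occurrences x ws + occurrences x vs
occurrences-++ x ws vs = trans (cong length (filter-++ (x ≟_) ws vs)) (length-++ (filter (x ≟_) ws))

length-filter-split : ∀ k ws → length ws ≡ occurrences k ws + length (filter (¬? ∘ (k ≟_)) ws)
length-filter-split k []       = refl
-- `≟` computes through `≡ᵇ`, so a split on this boolean lets both filters reduce.
length-filter-split k (w ∷ ws) with k ≡ᵇ w
... | true  = cong suc (length-filter-split k ws)
... | false = trans (cong suc (length-filter-split k ws)) (sym (+-suc _ _))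

occurrences-filter : ∀ x k ws → occurrences x (filter (¬? ∘ (k ≟_)) ws) ≤ occurrences x ws
occurrences-filter x k []       = z≤n
occurrences-filter x k (w ∷ ws) with k ≡ᵇ w
... | true with x ≡ᵇ w
...   | true  = m≤n⇒m≤1+n (occurrences-filter x k ws)
...   | false = occurrences-filter x k ws
occurrences-filter x k (w ∷ ws) | false with x ≡ᵇ w
...   | true  = s≤s (occurrences-filter x k ws)
...   | false = occurrences-filter x k ws

-- Pigeonhole by induction on the palette: deleting the top colour costs at most `r` entries and
-- raises no other count.
length≤*occurrences : ∀ k {r ws} → All (_< k) ws → (∀ {x} → x < k → occurrences x ws ≤ r) → length ws ≤ k * r
length≤*occurrences zero    []              _  = z≤n
length≤*occurrences (suc k) {r} {ws} ws≤k ≤r = begin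
  length ws                      ≡⟨ length-filter-split k ws ⟩
  occurrences k ws + length rest ≤⟨ +-mono-≤ (≤r ≤-refl) (length≤*occurrences k rest<k rest≤r) ⟩
  r + k * r                      ∎
  where
  open ≤-Reasoning
  rest = filter (¬? ∘ (k ≟_)) ws
  rest<k : All (_< k) rest
  rest<k = All.zipWith (λ { (s≤s w≤k , k≢w) → ≤∧≢⇒< w≤k (≢-sym k≢w) })
             (Allₚ.filter⁺ (¬? ∘ (k ≟_)) ws≤k , all-filter (¬? ∘ (k ≟_)) ws)
  rest≤r : ∀ {x} → x < k → occurrences x rest ≤ r
  rest≤r {x} x<k = ≤-trans (occurrences-filter x k ws) (≤r (m<n⇒m<1+n x<k))

unique⇒occurrences≤1 : ∀ {ws} → Unique ws → ∀ x → occurrences x ws ≤ 1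
unique⇒occurrences≤1 {ws} u x = constant (Uniqueₚ.filter⁺ (x ≟_) u) (all-filter (x ≟_) ws)
  where
  constant : ∀ {vs} → Unique vs → All (x ≡_) vs → length vs ≤ 1
  constant []                _                  = z≤n
  constant ([] ∷ _)          _                  = s≤s z≤n
  constant ((v≢w ∷ _) ∷ _)   (refl ∷ refl ∷ _)  = contradiction refl v≢w

unique⇒length≤ : ∀ k {ws} → All (_< k) ws → Unique ws → length ws ≤ k
unique⇒length≤ k ws<k u =
  subst (_ ≤_) (*-identityʳ k) (length≤*occurrences k ws<k (λ {x} _ → unique⇒occurrences≤1 u x))

-- The far ends of the half-edges at colour x; the second half of a loop at x is
-- recorded as the extra value k, so that the list has no repetitions.
partners : (k x : ℕ) → Step → List ℕ
partners k x (u , v) with x ≟ u | x ≟ v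
... | yes _ | yes _ = x ∷ k ∷ []
... | yes _ | no  _ = v ∷ []
... | no  _ | yes _ = u ∷ []
... | no  _ | no  _ = []

-- Each end of a step at `x` gives one entry; a loop has two ends there, hence its two entries.
length-partners : ∀ k x ss →
  length (concatMap (partners k x) ss) ≡ occurrences x (map proj₁ ss) + occurrences x (map proj₂ ss)
length-partners k x []             = refl
length-partners k x ((u , v) ∷ ss) with x ≟ u | x ≟ v
... | yes x≡u | yes x≡v
  rewrite occurrences-≡ x≡u (map proj₁ ss) | occurrences-≡ x≡v (map proj₂ ss)
  = cong suc (trans (cong suc (length-partners k x ss)) (sym (+-suc _ _)))
... | yes x≡u | no x≢v
  rewrite occurrences-≡ x≡u (map proj₁ ss) | occurrences-≢ x≢v (map proj₂ ss)
  = cong suc (length-partners k x ss)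
... | no x≢u | yes x≡v
  rewrite occurrences-≢ x≢u (map proj₁ ss) | occurrences-≡ x≡v (map proj₂ ss)
  = trans (cong suc (length-partners k x ss)) (sym (+-suc _ _))
... | no x≢u | no x≢v
  rewrite occurrences-≢ x≢u (map proj₁ ss) | occurrences-≢ x≢v (map proj₂ ss)
  = length-partners k x ss

module _ {k x : ℕ} (x<k : x < k) where

  partners-< : ∀ {s} → Every (_< k) s → All (_< suc k) (partners k x s)
  partners-< {u , v} (u<k , v<k) with x ≟ u | x ≟ v
  ... | yes _ | yes _ = m<n⇒m<1+n x<k ∷ ≤-refl ∷ []
  ... | yes _ | no  _ = m<n⇒m<1+n v<k ∷ []
  ... | no  _ | yes _ = m<n⇒m<1+n u<k ∷ []
  ... | no  _ | no  _ = []

  partners-unique : ∀ s → Unique (partners k x s)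
  partners-unique (u , v) with x ≟ u | x ≟ v
  ... | yes _ | yes _ = (<⇒≢ x<k ∷ []) ∷ [] ∷ []
  ... | yes _ | no  _ = [] ∷ []
  ... | no  _ | yes _ = [] ∷ []
  ... | no  _ | no  _ = []

  -- Decodes an entry of `partners`: the extra value `k` stands for the far end `x` of a loop.
  farEnd : ℕ → ℕ
  farEnd y with y ≟ k
  ... | yes _ = x
  ... | no  _ = y

  farEnd-< : ∀ {y} → y < k → farEnd y ≡ y
  farEnd-< {y} y<k with y ≟ k
  ... | yes y≡k = contradiction y≡k (<⇒≢ y<k)
  ... | no  _   = refl

  farEnd-k : farEnd k ≡ x
  farEnd-k with k ≟ k
  ... | yes _   = refl
  ... | no  k≢k = contradiction refl k≢k

  -- An entry determines the label of its step, so steps with different labels share no entry. This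
  -- makes the whole list of half-edges at `x` free of repetitions.
  partners-label : ∀ {s y} → Every (_< k) s → y ∈ partners k x s → SameLabel s (x , farEnd y)
  partners-label {u , v} (u<k , v<k) y∈ with x ≟ u | x ≟ v
  partners-label (u<k , v<k) (here refl)         | yes refl | yes refl = inj₁ (refl , sym (farEnd-< x<k))
  partners-label (u<k , v<k) (there (here refl)) | yes refl | yes refl = inj₁ (refl , sym farEnd-k)
  partners-label (u<k , v<k) (here refl)         | yes refl | no  _    = inj₁ (refl , sym (farEnd-< v<k))
  partners-label (u<k , v<k) (here refl)         | no  _    | yes refl = inj₂ (sym (farEnd-< u<k) , refl)

  partners-steps-unique : ∀ {ss} → All (Every (_< k)) ss → AllPairs Distinct ss →
                          Unique (concatMap (partners k x) ss)
  partners-steps-unique {ss} ss<k ds =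
    Uniqueₚ.concat⁺ (Allₚ.map⁺ (All.universal partners-unique ss)) (AllPairsₚ.map⁺ (disjoint ss<k ds))
    where
    disjoint : ∀ {ss} → All (Every (_< k)) ss → AllPairs Distinct ss →
               AllPairs (λ s t → Disjoint (partners k x s) (partners k x t)) ss
    disjoint []           []       = []
    disjoint (s<k ∷ ss<k) (d ∷ ds) =
      All.zipWith (λ { (s≁t , t<k) (y∈s , y∈t) →
        s≁t (sameLabel-trans (partners-label s<k y∈s) (sameLabel-sym (partners-label t<k y∈t))) }) (d , ss<k)
      ∷ disjoint ss<k ds

  degree-bound : ∀ {ss} → All (Every (_< k)) ss → AllPairs Distinct ss →
                 occurrences x (map proj₁ ss) + occurrences x (map proj₂ ss) ≤ suc k
  degree-bound {ss} ss<k ds = subst (_≤ suc k) (length-partners k x ss)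
    (unique⇒length≤ (suc k) (Allₚ.concat⁺ (Allₚ.map⁺ (All.map partners-< ss<k))) (partners-steps-unique ss<k ds))

double≤suc⇒≤half : ∀ {m} k → m + m ≤ suc k → m ≤ ⌈ k /2⌉
-- By definition `⌈ k /2⌉` is `⌊ suc k /2⌋`.
double≤suc⇒≤half {m} k 2m≤ = subst (_≤ ⌈ k /2⌉) (sym (n≡⌊n+n/2⌋ m)) (⌊n/2⌋-mono 2m≤)

module _ {x k m₂ m₃ : ℕ} (T : Trails x k m₂ m₃) where
  open Trails T

  -- One entry for each edge: the first `x` belongs to the loop, and each cycle adds its root and
  -- its other vertices.
  sources : List ℕ
  sources = x ∷ (x ∷ as) ++ (x ∷ bs)

  map-sources : map proj₁ (petalSteps x as bs) ≡ sources
  map-sources = cong (x ∷_) (trans (map-++ proj₁ (circuit x as) _)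
                  (cong₂ _++_ (sources-circuit x as) (sources-circuit x bs)))

  -- The targets of a closed walk are its sources rotated by one place. Hence a colour has twice as
  -- many half-edges as it has entries in `sources`.
  map-targets : map proj₂ (petalSteps x as bs) ↭ sources
  map-targets = subst (_↭ sources)
    (sym (cong (x ∷_) (trans (map-++ proj₂ (circuit x as) _)
      (cong₂ _++_ (targets-steps x (as ++ x ∷ [])) (targets-steps x (bs ++ x ∷ []))))))
    (prep x (↭-++⁺ (↭-sym (∷↭∷ʳ x as)) (↭-sym (∷↭∷ʳ x bs))))

  occurrences≤half : ∀ {y} → y < k → occurrences y sources ≤ ⌈ k /2⌉
  occurrences≤half {y} y<k = double≤suc⇒≤half k (subst₂ (λ m n → m + n ≤ suc k)
    (cong (occurrences y) map-sources) (occurrences-↭ y map-targets)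
    (degree-bound y<k ((x<k , x<k) ∷ Allₚ.++⁺ (circuit-every x<k as<k) (circuit-every x<k bs<k)) distinct))

  edges≤capacity : 3 + m₂ + m₃ ≤ capacity k
  edges≤capacity = subst (_≤ capacity k) edges
    (length≤*occurrences k (x<k ∷ x<k ∷ Allₚ.++⁺ as<k (x<k ∷ bs<k)) occurrences≤half)
    where
    edges : length sources ≡ 3 + m₂ + m₃
    edges = cong (2 +_) (trans (length-++ as {x ∷ bs}) (trans (cong₂ (λ m n → m + suc n) |as| |bs|) (+-suc m₂ m₃)))

  5≤colours : 5 ≤ k
  5≤colours = half≥3⇒5≤ k (≤-trans root≥3 (occurrences≤half x<k))
    where
    half≥3⇒5≤ : ∀ k → 3 ≤ ⌈ k /2⌉ → 5 ≤ k
    half≥3⇒5≤ k 3≤half with 5 ≤? k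
    ... | yes 5≤k = 5≤k
    ... | no  5≰k = contradiction (≤-trans 3≤half (⌈n/2⌉-mono (≤-pred (≰⇒> 5≰k)))) λ { (s≤s (s≤s ())) }
    root≥3 : 3 ≤ occurrences x sources
    root≥3 rewrite occurrences-≡ {x} refl (x ∷ as ++ x ∷ bs)
                 | occurrences-≡ {x} refl (as ++ x ∷ bs)
                 | occurrences-++ x as (x ∷ bs)
                 | occurrences-≡ {x} refl bs = s≤s (s≤s (m≤n⇒m≤o+n (occurrences x as) (s≤s z≤n)))

-- Enlarging the palette by two colours

-- For odd `k` this is 2k+3: the 2k edges from old to new colours, two loops and the edge between
-- the new colours. For even `k` it is 2k+2, without that last edge.
gain : ℕ → ℕ
gain k = 2 + k + 2 * ⌈ k /2⌉

-- The new colours p and q are joined to 0, 1, …, n.  Consuming the colours n, …, 1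
-- one at a time, alternating between p and q, the walk is at hub m when m are left
-- and ends at hub 0 = q.
module Detour (n : ℕ) where

  p q : ℕ
  p = suc n
  q = suc (suc n)

  hub : ℕ → ℕ
  hub 0             = q
  hub 1             = p
  hub (suc (suc m)) = hub m

  zigzag : ℕ → List ℕ
  zigzag zero    = []
  zigzag (suc m) = suc m ∷ hub m ∷ zigzag m

  -- From 0 to hub n, using the loop at p and, for odd palettes only, the edge p q.
  entry : ℕ → List ℕ
  entry 0             = p ∷ p ∷ q ∷ []
  entry 1             = p ∷ p ∷ []
  entry (suc (suc m)) = entry m

  detour : List ℕ
  detour = entry n ++ zigzag n ++ q ∷ []

  -- The two parities of `m`; in both, the entry stops at the hub where the zigzag starts.
  entry-hub : ∀ m → (entry m ≡ p ∷ p ∷ q ∷ [] × hub m ≡ q) ⊎ (entry m ≡ p ∷ p ∷ [] × hub m ≡ p)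
  entry-hub 0             = inj₁ (refl , refl)
  entry-hub 1             = inj₂ (refl , refl)
  entry-hub (suc (suc m)) = entry-hub m

  hub-≥ : ∀ m → p ≤ hub m
  hub-≥ m with entry-hub m
  ... | inj₁ (_ , h) = ≤-trans (n≤1+n p) (≤-reflexive (sym h))
  ... | inj₂ (_ , h) = ≤-reflexive (sym h)

  hub-≤ : ∀ m → hub m ≤ q
  hub-≤ m with entry-hub m
  ... | inj₁ (_ , h) = ≤-reflexive h
  ... | inj₂ (_ , h) = ≤-trans (≤-reflexive h) (n≤1+n p)

  -- Each old colour other than 0 is entered from one new colour and left to the other, so its two
  -- new edges are used once each.
  hub-alternates : ∀ m → hub m ≢ hub (suc m)
  hub-alternates 0             = 1+n≢n
  hub-alternates 1             = 1+n≢n ∘ sym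
  hub-alternates (suc (suc m)) = hub-alternates m

  length-detour : suc (length detour) ≡ gain (suc n)
  length-detour = begin
    suc (length detour)
      ≡⟨ cong suc (trans (length-++ (entry n))
           (cong (length (entry n) +_) (trans (length-++ (zigzag n)) (cong (_+ 1) (length-zigzag n))))) ⟩
    suc (length (entry n) + (2 * n + 1))
      ≡⟨ solve 2 (λ ℓ n → con 1 :+ (ℓ :+ (con 2 :* n :+ con 1)) := con 2 :+ n :+ (ℓ :+ n)) refl (length (entry n)) n ⟩
    2 + n + (length (entry n) + n)
      ≡⟨ cong (2 + n +_) (length-entry n) ⟩
    2 + n + (1 + 2 * ⌈ suc n /2⌉)
      ≡⟨ +-suc (2 + n) _ ⟩
    gain (suc n) ∎
    where
    open ≡-Reasoning
    open +-*-Solver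
    length-zigzag : ∀ m → length (zigzag m) ≡ 2 * m
    length-zigzag zero    = refl
    length-zigzag (suc m) = trans (cong (2 +_) (length-zigzag m)) (sym (*-suc 2 m))
    length-entry : ∀ m → length (entry m) + m ≡ 1 + 2 * ⌈ suc m /2⌉
    length-entry 0             = refl
    length-entry 1             = refl
    length-entry (suc (suc m)) = begin
      length (entry m) + (2 + m)  ≡⟨ solve 2 (λ ℓ m → ℓ :+ (con 2 :+ m) := con 2 :+ (ℓ :+ m)) refl (length (entry m)) m ⟩
      2 + (length (entry m) + m)  ≡⟨ cong (2 +_) (length-entry m) ⟩
      3 + 2 * ⌈ suc m /2⌉         ≡⟨ cong suc (sym (*-suc 2 ⌈ suc m /2⌉)) ⟩
      1 + 2 * suc ⌈ suc m /2⌉     ∎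

  detour-< : All (_< suc q) detour
  detour-< = Allₚ.++⁺ (entry-< n) (Allₚ.++⁺ (zigzag-< n ≤-refl) (≤-refl ∷ []))
    where
    entry-< : ∀ m → All (_< suc q) (entry m)
    entry-< 0             = n≤1+n q ∷ n≤1+n q ∷ ≤-refl ∷ []
    entry-< 1             = n≤1+n q ∷ n≤1+n q ∷ []
    entry-< (suc (suc m)) = entry-< m
    zigzag-< : ∀ m → m ≤ n → All (_< suc q) (zigzag m)
    zigzag-< zero    _   = []
    zigzag-< (suc m) m<n = s≤s (≤-trans m<n (m≤n+m n 2)) ∷ s≤s (hub-≤ m) ∷ zigzag-< m (<⇒≤ m<n)

  zigzagSteps : ℕ → List Step
  zigzagSteps zero    = []
  zigzagSteps (suc m) = (hub (suc m) , suc m) ∷ (suc m , hub m) ∷ zigzagSteps m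

  steps-zigzag : ∀ m ys → steps (hub m) (zigzag m ++ ys) ≡ zigzagSteps m ++ steps q ys
  steps-zigzag zero    ys = refl
  steps-zigzag (suc m) ys = cong (λ ss → (hub (suc m) , suc m) ∷ (suc m , hub m) ∷ ss) (steps-zigzag m ys)

  -- The hub index `j` is arbitrary, so properties that do not depend on the choice of hub need no
  -- parity argument.
  zigzagSteps-all : ∀ {P : Step → Set} m → m ≤ n →
    (∀ i j → 1 ≤ i → i ≤ m → P (hub j , i) × P (i , hub j)) → All P (zigzagSteps m)
  zigzagSteps-all zero    _   _  = []
  zigzagSteps-all (suc m) m<n f =
    proj₁ (f (suc m) (suc m) (s≤s z≤n) ≤-refl) ∷ proj₂ (f (suc m) m (s≤s z≤n) ≤-refl)
    ∷ zigzagSteps-all m (<⇒≤ m<n) (λ i j 1≤i i≤m → f i j 1≤i (m≤n⇒m≤1+n i≤m))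

  hub≢ : ∀ j {i} → i ≤ n → hub j ≢ i
  hub≢ j i≤n h≡i = <⇒≢ (≤-trans (s≤s i≤n) (hub-≥ j)) (sym h≡i)

  zigzagSteps-distinct : ∀ m → m ≤ n → AllPairs Distinct (zigzagSteps m)
  zigzagSteps-distinct zero    _   = []
  zigzagSteps-distinct (suc m) m<n =
    -- The two steps at `suc m` differ in their hubs; all later steps avoid `suc m`.
    (some-every-distinct {_≡ hub (suc m)} (inj₁ refl) (hub≢ (suc m) m<n ∘ sym , hub-alternates m)
       ∷ All.map (some-every-distinct {_≡ suc m} (inj₂ refl)) fresh)
    ∷ All.map (some-every-distinct {_≡ suc m} (inj₁ refl)) fresh
    ∷ zigzagSteps-distinct m (<⇒≤ m<n)
    where
    fresh : All (Every (_≢ suc m)) (zigzagSteps m)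
    fresh = zigzagSteps-all m (<⇒≤ m<n) λ i j _ i≤m →
      (hub≢ j m<n , <⇒≢ (s≤s i≤m)) , (<⇒≢ (s≤s i≤m) , hub≢ j m<n)

  exit : List Step
  exit = (q , q) ∷ (q , 0) ∷ []

  zigzag-low : All (Some (_≤ n)) (zigzagSteps n)
  zigzag-low = zigzagSteps-all n ≤-refl λ _ _ _ i≤n → inj₂ i≤n , inj₁ i≤n

  zigzag-avoids-0 : All (Every (_≢ 0)) (zigzagSteps n)
  zigzag-avoids-0 = zigzagSteps-all n ≤-refl λ i j 1≤i _ →
    (hub≢ j z≤n , ≢-sym (<⇒≢ 1≤i)) , (≢-sym (<⇒≢ 1≤i) , hub≢ j z≤n)

  high≁low : ∀ {x y s} → n < x → n < y → Some (_≤ n) s → Distinct (x , y) s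
  high≁low n<x n<y low = distinct-sym (some-every-distinct low (<⇒≱ n<x , <⇒≱ n<y))

  n<p : n < p
  n<p = ≤-refl

  n<q : n < q
  n<q = n≤1+n p

  p≢q : p ≢ q
  p≢q = 1+n≢n ∘ sym

  rest : List Step
  rest = zigzagSteps n ++ exit

  rest-distinct : AllPairs Distinct rest
  rest-distinct = AllPairsₚ.++⁺ (zigzagSteps-distinct n ≤-refl)
    ((high≁low n<q n<q (inj₂ z≤n) ∷ []) ∷ [] ∷ [])
    (All.zipWith (λ { (low , no0) →
        distinct-sym (high≁low n<q n<q low)
        ∷ distinct-sym (some-every-distinct {_≡ 0} (inj₂ refl) no0) ∷ [] })
      (zigzag-low , zigzag-avoids-0))

  0p≁rest : All (Distinct (0 , p)) rest
  0p≁rest = Allₚ.++⁺ (All.map (some-every-distinct {_≡ 0} (inj₁ refl)) zigzag-avoids-0)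
    (some-every-distinct {_≡ 0} (inj₁ refl) ((λ ()) , (λ ()))
     ∷ some-every-distinct {_≡ p} (inj₂ refl) (≢-sym p≢q , (λ ())) ∷ [])

  p-high≁rest : ∀ {x} → n < x → All (Distinct (p , x)) rest
  p-high≁rest n<x = Allₚ.++⁺ (All.map (high≁low n<p n<x) zigzag-low)
    (some-every-distinct {_≡ p} (inj₁ refl) (≢-sym p≢q , ≢-sym p≢q)
     ∷ high≁low n<p n<x (inj₂ z≤n) ∷ [])

  0p≁high : ∀ {x y} → 0 < x → 0 < y → Distinct (0 , p) (x , y)
  0p≁high 0<x 0<y = some-every-distinct {_≡ 0} (inj₁ refl) (≢-sym (<⇒≢ 0<x) , ≢-sym (<⇒≢ 0<y))

  pp≁pq : Distinct (p , p) (p , q)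
  pp≁pq = distinct-sym (some-every-distinct {_≡ q} (inj₂ refl) (p≢q , p≢q))

  -- The parity of `n` enters only here, as the presence or absence of the edge between `p` and `q`.
  shape : (circuit 0 detour ≡ (0 , p) ∷ (p , p) ∷ (p , q) ∷ rest) ⊎ (circuit 0 detour ≡ (0 , p) ∷ (p , p) ∷ rest)
  shape with entry-hub n
  ... | inj₁ (e , h) = inj₁ (begin
    circuit 0 (entry n ++ zigzag n ++ q ∷ [])
      ≡⟨ cong (λ es → circuit 0 (es ++ zigzag n ++ q ∷ [])) e ⟩
    (0 , p) ∷ (p , p) ∷ (p , q) ∷ steps q ((zigzag n ++ q ∷ []) ++ 0 ∷ [])
      ≡⟨ cong₂ (λ v ys → (0 , p) ∷ (p , p) ∷ (p , q) ∷ steps v ys) (sym h) (++-assoc (zigzag n) _ _) ⟩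
    (0 , p) ∷ (p , p) ∷ (p , q) ∷ steps (hub n) (zigzag n ++ q ∷ 0 ∷ [])
      ≡⟨ cong (λ ss → (0 , p) ∷ (p , p) ∷ (p , q) ∷ ss) (steps-zigzag n _) ⟩
    (0 , p) ∷ (p , p) ∷ (p , q) ∷ rest ∎)
    where open ≡-Reasoning
  ... | inj₂ (e , h) = inj₂ (begin
    circuit 0 (entry n ++ zigzag n ++ q ∷ [])
      ≡⟨ cong (λ es → circuit 0 (es ++ zigzag n ++ q ∷ [])) e ⟩
    (0 , p) ∷ (p , p) ∷ steps p ((zigzag n ++ q ∷ []) ++ 0 ∷ [])
      ≡⟨ cong₂ (λ v ys → (0 , p) ∷ (p , p) ∷ steps v ys) (sym h) (++-assoc (zigzag n) _ _) ⟩
    (0 , p) ∷ (p , p) ∷ steps (hub n) (zigzag n ++ q ∷ 0 ∷ [])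
      ≡⟨ cong (λ ss → (0 , p) ∷ (p , p) ∷ ss) (steps-zigzag n _) ⟩
    (0 , p) ∷ (p , p) ∷ rest ∎)
    where open ≡-Reasoning

  detour-distinct : AllPairs Distinct (circuit 0 detour)
  detour-distinct with shape
  ... | inj₁ eq = subst (AllPairs Distinct) (sym eq)
    ((0p≁high (s≤s z≤n) (s≤s z≤n) ∷ 0p≁high (s≤s z≤n) (s≤s z≤n) ∷ 0p≁rest)
     ∷ (pp≁pq ∷ p-high≁rest n<p) ∷ p-high≁rest n<q ∷ rest-distinct)
  ... | inj₂ eq = subst (AllPairs Distinct) (sym eq)
    ((0p≁high (s≤s z≤n) (s≤s z≤n) ∷ 0p≁rest) ∷ p-high≁rest n<p ∷ rest-distinct)

  rest-high : All (Some (n <_)) rest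
  rest-high = Allₚ.++⁺ (zigzagSteps-all n ≤-refl λ _ j _ _ → inj₁ (hub-≥ j) , inj₂ (hub-≥ j))
    (inj₁ n<q ∷ inj₁ n<q ∷ [])

  -- Every step of the detour has a new colour, so it cannot repeat a label of the old walks.
  detour-high : All (Some (n <_)) (circuit 0 detour)
  detour-high with shape
  ... | inj₁ eq = subst (All _) (sym eq) (inj₂ n<p ∷ inj₁ n<p ∷ inj₁ n<p ∷ rest-high)
  ... | inj₂ eq = subst (All _) (sym eq) (inj₂ n<p ∷ inj₁ n<p ∷ rest-high)

-- The second walk returns to colour 0, now at a vertex other than the root, and then follows the
-- detour. That extra 0 is why the growth is one more than `length detour`.
trails-extend : ∀ {k m₂ m₃} → Trails 0 k m₂ m₃ → Trails 0 (2 + k) m₂ (m₃ + gain k)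
trails-extend {suc n} {m₂} {m₃} (trails as bs |as| |bs| x<k as<k bs<k d) =
  trails as (bs ++ 0 ∷ detour) |as|
    (trans (length-++ bs) (cong₂ _+_ |bs| length-detour))
    (s≤s z≤n) (All.map weaken as<k) (Allₚ.++⁺ (All.map weaken bs<k) (s≤s z≤n ∷ detour-<))
    (subst (AllPairs Distinct) (sym split)
      (AllPairsₚ.++⁺ d detour-distinct (All.map (λ low → All.map (distinct-sym ∘ flip some-every-distinct low) detour-high) old)))
  where
  open Detour n
  weaken : ∀ {x} → x < suc n → x < 2 + suc n
  weaken x<k = ≤-trans x<k (m≤n+m (suc n) 2)
  old : All (Every (¬_ ∘ (n <_))) (petalSteps 0 as bs)
  old = (≮0 , ≮0) ∷ Allₚ.++⁺ (circuit-every ≮0 (All.map ≤⇒≯′ as<k)) (circuit-every ≮0 (All.map ≤⇒≯′ bs<k))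
    where
    ≮0 : ¬ (n < 0)
    ≮0 ()
    ≤⇒≯′ : ∀ {x} → x < suc n → ¬ (n < x)
    ≤⇒≯′ (s≤s x≤n) = ≤⇒≯ x≤n
  split : petalSteps 0 as (bs ++ 0 ∷ detour) ≡ petalSteps 0 as bs ++ circuit 0 detour
  split = cong ((0 , 0) ∷_) (begin
    circuit 0 as ++ circuit 0 (bs ++ 0 ∷ detour)
      ≡⟨ cong (λ ys → circuit 0 as ++ steps 0 ys) (++-assoc bs (0 ∷ detour) (0 ∷ [])) ⟩
    circuit 0 as ++ steps 0 (bs ++ 0 ∷ detour ++ 0 ∷ [])
      ≡⟨ cong (circuit 0 as ++_) (steps-++ 0 bs 0 _) ⟩
    circuit 0 as ++ (circuit 0 bs ++ circuit 0 detour)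
      ≡⟨ sym (++-assoc (circuit 0 as) _ _) ⟩
    (circuit 0 as ++ circuit 0 bs) ++ circuit 0 detour ∎)
    where open ≡-Reasoning

-- Small palettes

-- Loopless pairs of walks from 0; all remaining cases up to nine colours arise from
-- them by adding loops at 1, …, i to the first and at k ∸ j, …, k ∸ 1 to the second.
skeletons : List (List ℕ × List ℕ)
skeletons =
  (1 ∷ 2 ∷ [] , 3 ∷ 4 ∷ []) ∷
  (1 ∷ 2 ∷ [] , 3 ∷ 2 ∷ 4 ∷ []) ∷
  (1 ∷ 2 ∷ 3 ∷ [] , 2 ∷ 4 ∷ 1 ∷ 3 ∷ 4 ∷ []) ∷
  (1 ∷ 2 ∷ [] , 3 ∷ 2 ∷ 4 ∷ 3 ∷ 1 ∷ 4 ∷ []) ∷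
  (1 ∷ 2 ∷ [] , 3 ∷ 2 ∷ 4 ∷ 1 ∷ 5 ∷ 4 ∷ 3 ∷ 5 ∷ []) ∷
  (1 ∷ 2 ∷ 3 ∷ 4 ∷ 5 ∷ [] , 4 ∷ 2 ∷ 5 ∷ 1 ∷ 3 ∷ []) ∷
  (1 ∷ 2 ∷ [] , 3 ∷ 4 ∷ 5 ∷ 2 ∷ 4 ∷ 6 ∷ 2 ∷ 3 ∷ 5 ∷ 1 ∷ 4 ∷ []) ∷
  (1 ∷ 2 ∷ 3 ∷ 4 ∷ 5 ∷ [] , 4 ∷ 2 ∷ 6 ∷ 5 ∷ 1 ∷ 6 ∷ 4 ∷ 1 ∷ 3 ∷ 6 ∷ []) ∷
  (1 ∷ 2 ∷ 3 ∷ 1 ∷ 4 ∷ 3 ∷ 5 ∷ [] , 6 ∷ 1 ∷ 5 ∷ 6 ∷ 3 ∷ 0 ∷ 2 ∷ 4 ∷ []) ∷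
  (1 ∷ 2 ∷ 3 ∷ 1 ∷ 4 ∷ 3 ∷ 5 ∷ 6 ∷ [] , 5 ∷ 2 ∷ 4 ∷ 5 ∷ 1 ∷ 6 ∷ 4 ∷ 0 ∷ 2 ∷ 6 ∷ 3 ∷ []) ∷
  (1 ∷ 2 ∷ 3 ∷ 4 ∷ 0 ∷ 3 ∷ 5 ∷ 2 ∷ 4 ∷ 1 ∷ 6 ∷ [] ,
   5 ∷ 7 ∷ 3 ∷ 1 ∷ 5 ∷ 6 ∷ 4 ∷ 7 ∷ 6 ∷ 2 ∷ 7 ∷ []) ∷
  (1 ∷ 2 ∷ 3 ∷ 4 ∷ 5 ∷ 6 ∷ 0 ∷ 3 ∷ 1 ∷ 7 ∷ 2 ∷ 8 ∷ [] ,
   7 ∷ 3 ∷ 8 ∷ 5 ∷ 3 ∷ 6 ∷ 2 ∷ 0 ∷ 5 ∷ 1 ∷ 6 ∷ 7 ∷ 5 ∷ 2 ∷ 4 ∷ []) ∷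
  (1 ∷ 2 ∷ 0 ∷ 3 ∷ 1 ∷ 4 ∷ 5 ∷ 2 ∷ 6 ∷ 4 ∷ 3 ∷ 5 ∷ 6 ∷ 3 ∷ 7 ∷ [] ,
   5 ∷ 8 ∷ 2 ∷ 7 ∷ 6 ∷ 8 ∷ 1 ∷ 6 ∷ 0 ∷ 4 ∷ 7 ∷ 8 ∷ 4 ∷ 2 ∷ 3 ∷ 8 ∷ []) ∷ []

-- The loop goes to the last occurrence of a colour, so a colour met repeatedly receives only one.
addLoops : (ℕ → Bool) → List ℕ → List ℕ
addLoops p []       = []
addLoops p (v ∷ vs) =
  if p v ∧ not (any (v ≡ᵇ_) vs) then v ∷ v ∷ addLoops p vs else v ∷ addLoops p vs

-- As many loops are requested as the lengths still lack. Nothing is claimed about the outcome,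
-- which `valid?` checks.
candidate : (k m₂ m₃ : ℕ) → List ℕ × List ℕ → List ℕ × List ℕ
candidate k m₂ m₃ (α , β) =
  addLoops (λ v → (1 ≤ᵇ v) ∧ (v ≤ᵇ (m₂ ∸ length α))) α , addLoops ((k ∸ (m₃ ∸ length β)) ≤ᵇ_) β

Valid : (k m₂ m₃ : ℕ) → List ℕ × List ℕ → Set
Valid k m₂ m₃ (as , bs) =
  (length as ≡ m₂) × (length bs ≡ m₃) × All (_< k) as × All (_< k) bs × AllPairs Distinct (petalSteps 0 as bs)

valid? : ∀ k m₂ m₃ ws → Dec (Valid k m₂ m₃ ws)
valid? k m₂ m₃ (as , bs) =
  (length as ≟ m₂) ×-dec (length bs ≟ m₃) ×-dec All.all? (_<? k) as ×-dec All.all? (_<? k) bs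
  ×-dec allPairs? (λ s t → ¬? (sameLabel? s t)) (petalSteps 0 as bs)

Covered : (k m₂ m₃ : ℕ) → Set
Covered k m₂ m₃ = Any (Valid k m₂ m₃ ∘ candidate k m₂ m₃) skeletons

covered⇒trails : ∀ {k m₂ m₃} → 0 < k → Covered k m₂ m₃ → Trails 0 k m₂ m₃
covered⇒trails 0<k covered with Any.satisfied covered
... | _ , (|as| , |bs| , as<k , bs<k , d) = trails _ _ |as| |bs| 0<k as<k bs<k d

-- Bounds are phrased to suit `allUpTo?`. Totals up to `lo` are left out: they are impossible or fit
-- a smaller palette.
AllCovered : (k lo hi : ℕ) → Set
AllCovered k lo hi = ∀ {m₃} → m₃ < hi → ∀ {m₂} → m₂ < suc m₃ →
  2 ≤ m₂ → lo < 3 + m₂ + m₃ → 3 + m₂ + m₃ ≤ capacity k → Covered k m₂ m₃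

allCovered? : ∀ k lo hi → Dec (AllCovered k lo hi)
allCovered? k lo hi = allUpTo? (λ m₃ → allUpTo? (λ m₂ →
  (2 ≤? m₂) →-dec (lo <? 3 + m₂ + m₃) →-dec (3 + m₂ + m₃ ≤? capacity k) →-dec
  Any.any? (valid? k m₂ m₃ ∘ candidate k m₂ m₃) skeletons) (suc m₃)) hi

-- The total is at least 7, as both lengths are at least 2; 15 is `capacity 5`, which bounds `m₃`
-- too.
covered₅ : AllCovered 5 6 15
covered₅ = from-yes (allCovered? 5 6 15)

covered₆ : AllCovered 6 15 18
covered₆ = from-yes (allCovered? 6 15 18)

-- From `m₃ = 2 + gain 5` on, a detour can be cut off with length 2 to spare, so only smaller `m₃`
-- are checked.
covered₇ : AllCovered 7 (capacity 6) (2 + gain 5)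
covered₇ = from-yes (allCovered? 7 (capacity 6) (2 + gain 5))

covered₈ : AllCovered 8 (capacity 7) (2 + gain 6)
covered₈ = from-yes (allCovered? 8 (capacity 7) (2 + gain 6))

covered₉ : AllCovered 9 (capacity 8) (2 + gain 7)
covered₉ = from-yes (allCovered? 9 (capacity 8) (2 + gain 7))

-- All palettes

-- The lengths are unordered because cutting a detour off the longer cycle may make it the shorter
-- one.
Packs : ℕ → Set
Packs k = ∀ {m₂ m₃} → 2 ≤ m₂ → 2 ≤ m₃ → 3 + m₂ + m₃ ≤ capacity k → Trails 0 k m₂ m₃

packs-ordered : ∀ {k} →
  (∀ {m₂ m₃} → 2 ≤ m₂ → m₂ ≤ m₃ → 3 + m₂ + m₃ ≤ capacity k → Trails 0 k m₂ m₃) → Packs k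
packs-ordered {k} ordered {m₂} {m₃} 2≤m₂ 2≤m₃ fits with ≤-total m₂ m₃
... | inj₁ m₂≤m₃ = ordered 2≤m₂ m₂≤m₃ fits
... | inj₂ m₃≤m₂ = trails-swap (ordered 2≤m₃ m₃≤m₂ (subst (λ m → 3 + m ≤ capacity k) (+-comm m₂ m₃) fits))

capacity-gain : ∀ k → capacity (2 + k) ≡ capacity k + gain k
capacity-gain k =
  solve 2 (λ k h → (con 2 :+ k) :* (con 1 :+ h) := k :* h :+ (con 2 :+ k :+ con 2 :* h)) refl k ⌈ k /2⌉
  where open +-*-Solver

Remaining : ℕ → Set
Remaining k = ∀ {m₂ m₃} → 2 ≤ m₂ → m₂ ≤ m₃ → m₃ < 2 + gain k →
  capacity (suc k) < 3 + m₂ + m₃ → 3 + m₂ + m₃ ≤ capacity (2 + k) → Trails 0 (2 + k) m₂ m₃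

packs-step : ∀ {k} → Packs k → Packs (suc k) → Remaining k → Packs (2 + k)
packs-step {k} packs packs′ remaining = packs-ordered step
  where
  step : ∀ {m₂ m₃} → 2 ≤ m₂ → m₂ ≤ m₃ → 3 + m₂ + m₃ ≤ capacity (2 + k) → Trails 0 (2 + k) m₂ m₃
  step {m₂} {m₃} 2≤m₂ m₂≤m₃ fits with 3 + m₂ + m₃ ≤? capacity (suc k) | m₃ <? 2 + gain k
  ... | yes fits′ | _         = trails-suc (packs′ 2≤m₂ (≤-trans 2≤m₂ m₂≤m₃) fits′)
  ... | no  ¬fits | yes small = remaining 2≤m₂ m₂≤m₃ small (≰⇒> ¬fits) fits
  -- Cutting off `gain k` leaves at least 2, and the total drops by exactly the difference of the
  -- capacities, so `packs` applies to the rest.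
  ... | no  _     | no  large = subst (Trails 0 (2 + k) m₂) m₃′+gain
      (trails-extend (packs 2≤m₂ 2≤m₃′ (+-cancelʳ-≤ (gain k) _ _ (begin
        3 + m₂ + m₃′ + gain k    ≡⟨ +-assoc (3 + m₂) m₃′ (gain k) ⟩
        3 + m₂ + (m₃′ + gain k)  ≡⟨ cong (3 + m₂ +_) m₃′+gain ⟩
        3 + m₂ + m₃              ≤⟨ fits ⟩
        capacity (2 + k)         ≡⟨ capacity-gain k ⟩
        capacity k + gain k      ∎))))
    where
    open ≤-Reasoning
    m₃′ = m₃ ∸ gain k
    m₃′+gain : m₃′ + gain k ≡ m₃
    m₃′+gain = m∸n+n≡m (≤-trans (m≤n+m (gain k) 2) (≮⇒≥ large))
    2≤m₃′ : 2 ≤ m₃′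
    2≤m₃′ = subst (_≤ m₃′) (m+n∸n≡m 2 (gain k)) (∸-monoˡ-≤ (gain k) (≮⇒≥ large))

2*half : ∀ k → 2 * ⌈ k /2⌉ ≡ ⌈ k /2⌉ + ⌈ k /2⌉
2*half k = cong (⌈ k /2⌉ +_) (+-identityʳ _)

2*half≤ : ∀ k → 2 * ⌈ k /2⌉ ≤ suc k
2*half≤ k = begin
  2 * ⌈ k /2⌉               ≡⟨ 2*half k ⟩
  ⌈ k /2⌉ + ⌊ suc k /2⌋     ≤⟨ +-monoʳ-≤ ⌈ k /2⌉ (⌊n/2⌋≤⌈n/2⌉ (suc k)) ⟩
  ⌊ suc k /2⌋ + ⌈ suc k /2⌉ ≡⟨ ⌊n/2⌋+⌈n/2⌉≡n (suc k) ⟩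
  suc k                     ∎
  where open ≤-Reasoning

≤2*half : ∀ k → k ≤ 2 * ⌈ k /2⌉
≤2*half k = begin
  k                     ≡⟨ ⌊n/2⌋+⌈n/2⌉≡n k ⟨
  ⌊ k /2⌋ + ⌈ k /2⌉     ≤⟨ +-monoˡ-≤ ⌈ k /2⌉ (⌊n/2⌋≤⌈n/2⌉ k) ⟩
  ⌈ k /2⌉ + ⌈ k /2⌉     ≡⟨ 2*half k ⟨
  2 * ⌈ k /2⌉           ∎
  where open ≤-Reasoning

covered⇒remaining : ∀ k → AllCovered (2 + k) (capacity (suc k)) (2 + gain k) → Remaining k
covered⇒remaining k covered 2≤m₂ m₂≤m₃ small ¬fits fits =
  covered⇒trails (s≤s z≤n) (covered small (s≤s m₂≤m₃) 2≤m₂ ¬fits fits)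

-- With `k = 8 + j`, two cycles too short for a detour have at most 4k+11 edges in all, fewer than
-- 5(k+1), which is at most `capacity (suc k)`. So no such case remains.
remaining-large : ∀ j → Remaining (8 + j)
remaining-large j {m₂} {m₃} 2≤m₂ m₂≤m₃ (s≤s m₃≤) ¬fits _ = ⊥-elim (<-irrefl refl (begin-strict
  45 + 5 * j                     ≡⟨ solve 1 (λ j → con 45 :+ con 5 :* j := (con 9 :+ j) :* con 5) refl j ⟩
  suc k * 5                      ≤⟨ *-monoʳ-≤ (suc k) (⌈n/2⌉-mono (m≤m+n 9 j)) ⟩
  capacity (suc k)               <⟨ ¬fits ⟩
  3 + m₂ + m₃                    ≤⟨ +-mono-≤ (+-monoʳ-≤ 3 (≤-trans m₂≤m₃ m₃≤)) m₃≤ ⟩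
  3 + (1 + gain k) + (1 + gain k)
    ≡⟨ solve 2 (λ j 2h → con 3 :+ (con 1 :+ (con 10 :+ j :+ 2h)) :+ (con 1 :+ (con 10 :+ j :+ 2h))
                         := con 25 :+ con 2 :* j :+ con 2 :* 2h) refl j (2 * ⌈ k /2⌉) ⟩
  25 + 2 * j + 2 * (2 * ⌈ k /2⌉) ≤⟨ +-monoʳ-≤ (25 + 2 * j) (*-monoʳ-≤ 2 (2*half≤ k)) ⟩
  25 + 2 * j + 2 * suc k         ≡⟨ solve 1 (λ j → con 25 :+ con 2 :* j :+ con 2 :* (con 9 :+ j)
                                                   := con 43 :+ con 4 :* j) refl j ⟩
  43 + 4 * j                     ≤⟨ +-mono-≤ (m≤m+n 43 2) (*-monoˡ-≤ j (n≤1+n 4)) ⟩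
  45 + 5 * j                     ∎))
  where
  open ≤-Reasoning
  open +-*-Solver
  k = 8 + j

packs : ∀ j → Packs (5 + j)
packs 0 = packs-ordered λ {m₂} {m₃} 2≤m₂ m₂≤m₃ fits →
  covered⇒trails (s≤s z≤n) (covered₅ (≤-trans (s≤s (m≤n+m m₃ (2 + m₂))) fits) (s≤s m₂≤m₃) 2≤m₂
    (+-mono-≤ (+-monoʳ-≤ 3 2≤m₂) (≤-trans 2≤m₂ m₂≤m₃)) fits)
packs 1 = packs-ordered step
  where
  step : ∀ {m₂ m₃} → 2 ≤ m₂ → m₂ ≤ m₃ → 3 + m₂ + m₃ ≤ capacity 6 → Trails 0 6 m₂ m₃
  step {m₂} {m₃} 2≤m₂ m₂≤m₃ fits with 3 + m₂ + m₃ ≤? capacity 5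
  ... | yes fits′ = trails-suc (packs 0 2≤m₂ (≤-trans 2≤m₂ m₂≤m₃) fits′)
  ... | no  ¬fits = covered⇒trails (s≤s z≤n)
      (covered₆ (≤-trans (s≤s (m≤n+m m₃ (2 + m₂))) fits) (s≤s m₂≤m₃) 2≤m₂ (≰⇒> ¬fits) fits)
packs (suc (suc j)) = packs-step (packs j) (packs (suc j)) (remaining j)
  where
  remaining : ∀ j → Remaining (5 + j)
  remaining 0                   = covered⇒remaining 5 covered₇
  remaining 1                   = covered⇒remaining 6 covered₈
  remaining 2                   = covered⇒remaining 7 covered₉
  remaining (suc (suc (suc j))) = remaining-large j

-- The chromatic number

module _ {m₂ m₃ : ℕ} where

  e : ℕ
  e = 1 + suc m₂ + suc m₃

  e≡ : e ≡ 3 + m₂ + m₃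
  e≡ = cong (2 +_) (+-suc m₂ m₃)

  colourable : ∀ {k} → 2 ≤ m₂ → 2 ≤ m₃ → 5 ≤ k → e ≤ capacity k → EDColourable (Petal (suc m₂) (suc m₃)) k
  colourable {k} 2≤m₂ 2≤m₃ 5≤k fits = trails⇒colouring
    (subst (λ k → Trails 0 k m₂ m₃) (m+[n∸m]≡n 5≤k)
      (packs (k ∸ 5) 2≤m₂ 2≤m₃ (subst₂ _≤_ e≡ (cong capacity (sym (m+[n∸m]≡n 5≤k))) fits)))

  colourable⇒5≤ : ∀ {k} → EDColourable (Petal (suc m₂) (suc m₃)) k → 5 ≤ k
  colourable⇒5≤ c = 5≤colours (proj₂ (colouring⇒trails c))

  colourable⇒e≤capacity : ∀ {k} → EDColourable (Petal (suc m₂) (suc m₃)) k → e ≤ capacity k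
  colourable⇒e≤capacity {k} c = subst (_≤ capacity k) (sym e≡) (edges≤capacity (proj₂ (colouring⇒trails c)))

-- From the capacity to the two ceilings

2*capacity : ∀ k → 2 * capacity k ≡ k * (2 * ⌈ k /2⌉)
2*capacity k = solve 2 (λ k h → con 2 :* (k :* h) := k :* (con 2 :* h)) refl k ⌈ k /2⌉
  where open +-*-Solver

-- Used with `n` equal to k+1 for every `k`, and equal to `k` for even `k`; these are the
-- inequalities in `CeilTri` and `CeilSqrt2`.
≤capacity⇒ : ∀ {e n} k → 2 * ⌈ k /2⌉ ≤ n → e ≤ capacity k → 2 * e ≤ k * n
≤capacity⇒ {e} {n} k half≤ e≤ = begin
  2 * e               ≤⟨ *-monoʳ-≤ 2 e≤ ⟩
  2 * capacity k      ≡⟨ 2*capacity k ⟩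
  k * (2 * ⌈ k /2⌉)   ≤⟨ *-monoʳ-≤ k half≤ ⟩
  k * n               ∎
  where open ≤-Reasoning

≤capacity⇐ : ∀ {e n} k → n ≤ 2 * ⌈ k /2⌉ → 2 * e ≤ k * n → e ≤ capacity k
≤capacity⇐ {e} {n} k ≤half 2e≤ = *-cancelˡ-≤ 2 (begin
  2 * e               ≤⟨ 2e≤ ⟩
  k * n               ≤⟨ *-monoʳ-≤ k ≤half ⟩
  k * (2 * ⌈ k /2⌉)   ≡⟨ 2*capacity k ⟨
  2 * capacity k      ∎)
  where open ≤-Reasoning

2*half-odd : ∀ k → Odd k → 2 * ⌈ k /2⌉ ≡ suc k
2*half-odd _ (m , refl) = begin
  2 * suc ⌊ 2 * m /2⌋      ≡⟨ cong (λ n → 2 * suc ⌊ m + n /2⌋) (+-identityʳ m) ⟩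
  2 * suc ⌊ m + m /2⌋      ≡⟨ cong (λ n → 2 * suc n) (n≡⌊n+n/2⌋ m) ⟨
  2 * suc m                ≡⟨ *-suc 2 m ⟩
  suc (suc (2 * m))        ∎
  where open ≡-Reasoning

2*half-even-or-odd : ∀ k → 2 * ⌈ k /2⌉ ≡ k ⊎ Odd k
2*half-even-or-odd 0             = inj₁ refl
2*half-even-or-odd 1             = inj₂ (0 , refl)
2*half-even-or-odd (suc (suc k)) with 2*half-even-or-odd k
... | inj₁ even       = inj₁ (trans (*-suc 2 ⌈ k /2⌉) (cong (2 +_) even))
... | inj₂ (m , refl) = inj₂ (suc m , cong suc (sym (*-suc 2 m)))

-- For `k ≤ 4` the product is at most 4·5 = 20, while 22 is twice the least edge number 11 of the
-- general cases.
square-bound⇒5≤ : ∀ {k n m} → n ≤ suc k → 22 ≤ m → m ≤ k * n → 5 ≤ k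
square-bound⇒5≤ {k} n≤ 22≤m m≤ with 5 ≤? k
... | yes 5≤k = 5≤k
... | no  5≰k = contradiction (≤-trans 22≤m (≤-trans m≤ (*-mono-≤ k≤4 (≤-trans n≤ (s≤s k≤4))))) (<⇒≱ (m≤m+n 21 1))
  where k≤4 = ≤-pred (≰⇒> 5≰k)

theorem4p1 : (c2 c3 : ℕ) → 3 ≤ c2 → c2 ≤ c3 →
    ((1 + c2 + c3 ≤ 10) → EDChromaticNumber (Petal c2 c3) 5)
    × (11 ≤ 1 + c2 + c3 → ∀ t → CeilTri (1 + c2 + c3) t → Odd t →
    EDChromaticNumber (Petal c2 c3) t)
    × (11 ≤ 1 + c2 + c3 → ∀ t → CeilTri (1 + c2 + c3) t → ¬ Odd t →
    ∀ s → CeilSqrt2 (1 + c2 + c3) s → EDChromaticNumber (Petal c2 c3) s)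
theorem4p1 (suc m₂) (suc m₃) (s≤s 2≤m₂) (s≤s m₂≤m₃) = few , odd , even
  where
  G = Petal (suc m₂) (suc m₃)
  n = e {m₂} {m₃}

  -- The two conditions characterise colourability, so only arithmetic is left.
  chromatic : ∀ {k} → 5 ≤ k → n ≤ capacity k → (∀ j → j < k → ¬ (5 ≤ j × n ≤ capacity j)) → EDChromaticNumber G k
  chromatic 5≤k fits least =
    ≤-trans (s≤s z≤n) 5≤k , colourable 2≤m₂ (≤-trans 2≤m₂ m₂≤m₃) 5≤k fits ,
    λ j _ j<k c → least j j<k (colourable⇒5≤ c , colourable⇒e≤capacity c)

  few : n ≤ 10 → EDChromaticNumber G 5
  few n≤10 = chromatic ≤-refl (≤-trans n≤10 (m≤m+n 10 5)) λ _ j<5 (5≤j , _) → <⇒≱ j<5 5≤j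

  odd : 11 ≤ n → ∀ t → CeilTri n t → Odd t → EDChromaticNumber G t
  odd 11≤n t (2n≤ , least) t-odd = chromatic
    (square-bound⇒5≤ (≤-reflexive (+-comm t 1)) (*-monoʳ-≤ 2 11≤n) 2n≤)
    -- For odd `t` the capacity is exactly t(t+1)/2; for smaller `j` of either parity j(j+1)/2 is an
    -- upper bound, which suffices for minimality.
    (≤capacity⇐ t (≤-reflexive (trans (+-comm t 1) (sym (2*half-odd t t-odd)))) 2n≤)
    λ j j<t (_ , fits) → least j j<t (≤capacity⇒ j (≤-trans (2*half≤ j) (≤-reflexive (+-comm 1 j))) fits)

  even : 11 ≤ n → ∀ t → CeilTri n t → ¬ Odd t → ∀ s → CeilSqrt2 n s → EDChromaticNumber G s
  even 11≤n t (2n≤ , leastTri) t-even s (2n≤s² , leastSqrt) = chromatic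
    (square-bound⇒5≤ (n≤1+n s) (*-monoʳ-≤ 2 11≤n) 2n≤s²)
    -- The capacity is at least s²/2 for either parity of `s`.
    (≤capacity⇐ s (≤2*half s) 2n≤s²)
    λ j j<s (_ , fits) → leastSqrt j j<s (square j fits)
    where
    -- An odd j beyond the even t satisfies j ≥ t + 1, so j² ≥ t (t + 1) ≥ 2n.
    square : ∀ j → n ≤ capacity j → 2 * n ≤ j * j
    square j fits with 2*half-even-or-odd j
    ... | inj₁ j-even = ≤capacity⇒ j (≤-reflexive j-even) fits
    ... | inj₂ j-odd  = ≤-trans 2n≤ (*-mono-≤ (<⇒≤ t<j) (≤-trans (≤-reflexive (+-comm t 1)) t<j))
      where
      t<j : t < j
      t<j with <-cmp t j
      ... | tri< t<j _ _    = t<j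
      ... | tri≈ _ refl _   = contradiction j-odd t-even
      ... | tri> _ _ j<t    = contradiction
              (≤capacity⇒ j (≤-trans (2*half≤ j) (≤-reflexive (+-comm 1 j))) fits) (leastTri j j<t)
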